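{- (In ZFC.) Every finite Boolean algebra $B$ is injective in the category of distributive lattices: for every injective lattice map $\phi:L\to L'$ between bounded distributive lattices and every lattice map $\alpha:L\to B$ there is a lattice map $\beta:L'\to B$ with $\alpha=\beta\circ\phi$.
   Context: Lattices are distributive and bounded; lattice maps preserve $\wedge,\vee,0,1$. The ambient theory is classical set theory with choice (ZFC). -}

module Defs where

open import Algebra.Lattice.Bundles using (BooleanAlgebra; DistributiveLattice)
open import Algebra.Lattice.Morphism.Structures using (IsLatticeHomomorphism)
open import Algebra.Lattice.Structures using (IsDistributiveLattice)
import Algebra.Definitions as AlgebraDefinitions
import Algebra.Lattice.Properties.BooleanAlgebra as BooleanAlgebraProperties
open import Algebra.Core using (Op₂)
open import Data.Fin.Base using (Fin)
open import Data.Product.Base using (Σ-syntax; ∃-syntax)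
open import Function.Bundles using (Func; Inverse; Surjection)
import Function.Definitions as FunctionDefinitions
open import Level using (_⊔_; suc; Setω)
open import Relation.Binary.Bundles using (Setoid)
open import Relation.Binary.Core using (Rel)
import Relation.Binary.PropositionalEquality.Properties as ≡

-- Choice for sets, a set being a setoid: every surjection splits.  The
-- section is a `Func`, i.e. it respects the setoid equalities; without
-- this requirement the principle would be provable and say nothing.
AxiomOfChoice : ∀ a ℓ₁ b ℓ₂ → Set (suc (a ⊔ ℓ₁ ⊔ b ⊔ ℓ₂))
AxiomOfChoice a ℓ₁ b ℓ₂ =
  (A : Setoid a ℓ₁) (B : Setoid b ℓ₂) (f : Surjection A B) →
  Σ[ g ∈ Func B A ] (∀ y → Setoid._≈_ B (Surjection.to f (Func.to g y)) y)

Finite : ∀ {a ℓ} → Setoid a ℓ → Set (a ⊔ ℓ)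
Finite A = ∃[ n ] Inverse A (≡.setoid (Fin n))

-- The trivial lattice, in which ⊤ ≈ ⊥, is allowed.
record BoundedDistributiveLattice c ℓ : Set (suc (c ⊔ ℓ)) where
  infixr 7 _∧_
  infixr 6 _∨_
  infix  4 _≈_
  field
    Carrier               : Set c
    _≈_                   : Rel Carrier ℓ
    _∨_                   : Op₂ Carrier
    _∧_                   : Op₂ Carrier
    ⊤                     : Carrier
    ⊥                     : Carrier
    isDistributiveLattice : IsDistributiveLattice _≈_ _∨_ _∧_
    ∧-identity            : AlgebraDefinitions.Identity _≈_ ⊤ _∧_
    ∨-identity            : AlgebraDefinitions.Identity _≈_ ⊥ _∨_

  open IsDistributiveLattice isDistributiveLattice public

  distributiveLattice : DistributiveLattice c ℓ
  distributiveLattice = record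
    { isDistributiveLattice = isDistributiveLattice }

  open DistributiveLattice distributiveLattice public
    using (_≉_; setoid; rawLattice; lattice)

boundedDistributiveLattice :
  ∀ {c ℓ} → BooleanAlgebra c ℓ → BoundedDistributiveLattice c ℓ
boundedDistributiveLattice B = record
  { isDistributiveLattice = isDistributiveLattice
  ; ∧-identity            = ∧-identity
  ; ∨-identity            = ∨-identity
  }
  where
  open BooleanAlgebra B using (isDistributiveLattice)
  open BooleanAlgebraProperties B using (∧-identity; ∨-identity)

record LatticeMap {c₁ ℓ₁ c₂ ℓ₂}
                  (L : BoundedDistributiveLattice c₁ ℓ₁)
                  (M : BoundedDistributiveLattice c₂ ℓ₂)
                  : Set (c₁ ⊔ ℓ₁ ⊔ c₂ ⊔ ℓ₂) where
  private
    module L = BoundedDistributiveLattice L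
    module M = BoundedDistributiveLattice M
  field
    to                    : L.Carrier → M.Carrier
    isLatticeHomomorphism : IsLatticeHomomorphism L.rawLattice M.rawLattice to
    ⊤-homo                : to L.⊤ M.≈ M.⊤
    ⊥-homo                : to L.⊥ M.≈ M.⊥

  open IsLatticeHomomorphism isLatticeHomomorphism public

  Injective : Set (c₁ ⊔ ℓ₁ ⊔ ℓ₂)
  Injective = FunctionDefinitions.Injective L._≈_ M._≈_ to

-- Injectivity is tested against lattices of every universe level.
IsInjectiveObject : ∀ {b ℓ} → BoundedDistributiveLattice b ℓ → Setω
IsInjectiveObject B =
  ∀ {c₁ ℓ₁ c₂ ℓ₂}
  (L  : BoundedDistributiveLattice c₁ ℓ₁)
  (L′ : BoundedDistributiveLattice c₂ ℓ₂)
  (φ : LatticeMap L L′) → LatticeMap.Injective φ →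
  (α : LatticeMap L B) →
  Σ[ β ∈ LatticeMap L′ B ]
    (∀ x → BoundedDistributiveLattice._≈_ B
             (LatticeMap.to α x)
             (LatticeMap.to β (LatticeMap.to φ x)))

{-# OPTIONS --safe #-}
-- Below each atom e of B choose, by the prime filter theorem, a prime filter
-- of L′ that contains φ x exactly when e ≤ α x; injectivity of φ is what makes
-- the filter and the ideal to be separated disjoint.  Then β y is the join of
-- the atoms whose filter contains y, and β is a homomorphism because an element
-- of B is determined by the atoms below it.
--
-- The prime filter theorem is proved in the style of Bourbaki–Witt.  By choice
-- there is an extensional operation that enlarges every non-maximal filter
-- disjoint from the ideal by one more generator.  The subsets obtained from the
-- given filter by this operation and by unions form a chain; its union is
-- closed under the operation, hence maximal, hence prime.
module Submission where

open import Defs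
open import Algebra.Lattice.Bundles using (BooleanAlgebra)
open import Axiom.ExcludedMiddle using (ExcludedMiddle)

open import Data.Bool.Base using (Bool; true; T)
open import Data.Fin.Base using (Fin; zero; suc)
open import Data.Nat.Base using (zero; suc)
open import Data.Product.Base using (Σ-syntax; ∃-syntax; _×_; _,_; proj₁; proj₂)
open import Data.Sum.Base using (_⊎_; inj₁; inj₂; [_,_]′)
open import Function.Base using (id; _∘_)
open import Function.Bundles using (Func; Inverse)
open import Level using (0ℓ; _⊔_)
open import Relation.Binary.Bundles using (Setoid)
open import Relation.Binary.PropositionalEquality.Core using (_≡_; refl; sym; trans; subst)
open import Relation.Nullary.Decidable.Core
  using (Dec; yes; no; ⌊_⌋; toWitness; fromWitness)
open import Relation.Nullary.Negation.Core using (¬_; contradiction)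
import Algebra.Lattice.Properties.Lattice as LatticeProperties
import Relation.Binary.Lattice.Bundles as OrderTheoretic
import Relation.Binary.Lattice.Properties.MeetSemilattice as MeetProperties

-- Since excluded middle decides every type, Bool-valued subsets of X capture
-- predicates of every level while Subset X stays at the level of X.
Subset : ∀ {c} → Set c → Set c
Subset X = X → Bool

module _ {c} {X : Set c} where

  infix 4 _∈_ _⊆_ _≐_

  _∈_ : X → Subset X → Set
  x ∈ P = T (P x)

  _⊆_ : Subset X → Subset X → Set c
  P ⊆ Q = ∀ x → x ∈ P → x ∈ Q

  _≐_ : Subset X → Subset X → Set c
  P ≐ Q = P ⊆ Q × Q ⊆ P

-- Order, filters and ideals.

module Order {c ℓ} (L : BoundedDistributiveLattice c ℓ) where
  open BoundedDistributiveLattice L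

  orderLattice : OrderTheoretic.Lattice c ℓ ℓ
  orderLattice = LatticeProperties.∨-∧-orderTheoreticLattice lattice

  open OrderTheoretic.Lattice orderLattice public
    using (_≤_; antisym; x∧y≤x; x∧y≤y; ∧-greatest; x≤x∨y; y≤x∨y; ∨-least)
    renaming (refl to ≤-refl; trans to ≤-trans; reflexive to ≤-reflexive)
  open MeetProperties (OrderTheoretic.Lattice.meetSemilattice orderLattice) public
    using (∧-monotonic)

  x≤⊤ : ∀ {x} → x ≤ ⊤
  x≤⊤ = Setoid.sym setoid (proj₂ ∧-identity _)

  ⊥≤x : ∀ {x} → ⊥ ≤ x
  ⊥≤x {x} = ≤-trans (x≤x∨y ⊥ x) (≤-reflexive (proj₁ ∨-identity x))

module _ {c ℓ p} (L : BoundedDistributiveLattice c ℓ)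
         (F : BoundedDistributiveLattice.Carrier L → Set p) where
  open BoundedDistributiveLattice L
  open Order L

  record IsFilter : Set (c ⊔ ℓ ⊔ p) where
    field
      ⊤-closed : F ⊤
      ∧-closed : ∀ {x y} → F x → F y → F (x ∧ y)
      up       : ∀ {x y} → x ≤ y → F x → F y

  record IsIdeal : Set (c ⊔ ℓ ⊔ p) where
    field
      ⊥-closed : F ⊥
      ∨-closed : ∀ {x y} → F x → F y → F (x ∨ y)
      down     : ∀ {x y} → x ≤ y → F y → F x

  record IsPrimeFilter : Set (c ⊔ ℓ ⊔ p) where
    field
      isFilter : IsFilter
      prime    : ∀ {x y} → F (x ∨ y) → F x ⊎ F y

    open IsFilter isFilter public

module _ {c₁ ℓ₁ c₂ ℓ₂} {L : BoundedDistributiveLattice c₁ ℓ₁}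
         {M : BoundedDistributiveLattice c₂ ℓ₂} (f : LatticeMap L M) where
  private
    module L = BoundedDistributiveLattice L
    module M = BoundedDistributiveLattice M
    module f = LatticeMap f

  mono : ∀ {x y} → Order._≤_ L x y → Order._≤_ M (f.to x) (f.to y)
  mono x≤y = M.trans (f.⟦⟧-cong x≤y) (f.∧-homo _ _)

  reflect : f.Injective → ∀ {x y} → Order._≤_ M (f.to x) (f.to y) → Order._≤_ L x y
  reflect inj fx≤fy = inj (M.trans fx≤fy (M.sym (f.∧-homo _ _)))

module Classical (em : ∀ ℓ → ExcludedMiddle ℓ) where

  module _ {c a} {X : Set c} (A : X → Set a) where

    ⟪_⟫ : Subset X
    ⟪_⟫ x = ⌊ em a {A x} ⌋

    ∈⁺ : ∀ {x} → A x → x ∈ ⟪_⟫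
    ∈⁺ {x} = fromWitness {a? = em a {A x}}

    ∈⁻ : ∀ {x} → x ∈ ⟪_⟫ → A x
    ∈⁻ {x} = toWitness {a? = em a {A x}}

  -- Chains generated by an inflationary operation.

  module Tower {c} {X : Set c} (F₀ : Subset X) (g : Subset X → Subset X)
               (g-inflationary : ∀ P → P ⊆ g P)
               (g-extensional : ∀ P Q → P ≐ Q → g P ⊆ g Q) where

    -- F₀ is included in every union, so the empty union starts the tower.
    InUnion : Subset (Subset X) → X → Set c
    InUnion S x = x ∈ F₀ ⊎ ∃[ P ] P ∈ S × x ∈ P

    ⋃ : Subset (Subset X) → Subset X
    ⋃ S = ⟪ InUnion S ⟫

    -- The index of `sup` is a Bool-valued family, so `⟪ Tower ⟫` is itself an admissible index;
    -- this is how `top` gets into the tower.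
    data Tower : Subset X → Set c where
      step : ∀ {P} → Tower P → Tower (g P)
      sup  : ∀ S → (∀ P → P ∈ S → Tower P) → Tower (⋃ S)

    ⊆⋃ : ∀ S P → P ∈ S → P ⊆ ⋃ S
    ⊆⋃ S P P∈S x x∈P = ∈⁺ (InUnion S) (inj₂ (P , P∈S , x∈P))

    F₀⊆ : ∀ {P} → Tower P → F₀ ⊆ P
    F₀⊆ (step {P} t) x x∈F₀ = g-inflationary P x (F₀⊆ t x x∈F₀)
    F₀⊆ (sup S _)    x x∈F₀ = ∈⁺ (InUnion S) (inj₁ x∈F₀)

    ⋃⊆ : ∀ S {Q} → Tower Q → (∀ P → P ∈ S → P ⊆ Q) → ⋃ S ⊆ Q
    ⋃⊆ S t S⊆ x x∈⋃ with ∈⁻ (InUnion S) x∈⋃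
    ... | inj₁ x∈F₀           = F₀⊆ t x x∈F₀
    ... | inj₂ (P , P∈S , x∈P) = S⊆ P P∈S x x∈P

    -- The extreme points of the Bourbaki-Witt argument. The alternative `C ⊆ P` replaces the usual
    -- restriction to proper inclusions.
    Extreme : Subset X → Set c
    Extreme C = ∀ {P} → Tower P → P ⊆ C → C ⊆ P ⊎ g P ⊆ C

    -- Induction on `P`: extremeness of `C` keeps a step from jumping past `C`, and a union stays
    -- inside `C` unless some member already contains `g C`.
    extreme-comparable : ∀ {C} → Tower C → Extreme C →
                         ∀ {P} → Tower P → P ⊆ C ⊎ g C ⊆ P
    extreme-comparable {C} tC ext (step {P} tP) with extreme-comparable tC ext tP
    ... | inj₂ gC⊆P = inj₂ λ x → g-inflationary P x ∘ gC⊆P x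
    ... | inj₁ P⊆C with ext tP P⊆C
    -- `C` and `P` have the same elements but need not be the same function, hence the appeal to
    -- extensionality of `g`.
    ...   | inj₁ C⊆P  = inj₂ (g-extensional C P (C⊆P , P⊆C))
    ...   | inj₂ gP⊆C = inj₁ gP⊆C
    extreme-comparable {C} tC ext (sup S tS)
      with em c {∃[ P ] P ∈ S × g C ⊆ P}
    ... | yes (P , P∈S , gC⊆P) = inj₂ λ x → ⊆⋃ S P P∈S x ∘ gC⊆P x
    ... | no ∄ = inj₁ (⋃⊆ S tC λ P P∈S →
      [ id , (λ gC⊆P → contradiction (P , P∈S , gC⊆P) ∄) ]′
        (extreme-comparable tC ext (tS P P∈S)))

    -- Induction on `C`: `P` is compared with the predecessor of `C`, or with the members of the
    -- union.
    extreme : ∀ {C} → Tower C → Extreme C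
    extreme (step {C} tC) {P} tP P⊆gC with extreme-comparable tC (extreme tC) tP
    ... | inj₂ gC⊆P = inj₁ gC⊆P
    ... | inj₁ P⊆C with extreme tC tP P⊆C
    ...   | inj₁ C⊆P  = inj₂ (g-extensional P C (P⊆C , C⊆P))
    ...   | inj₂ gP⊆C = inj₂ λ x → g-inflationary C x ∘ gP⊆C x
    extreme (sup S tS) {P} tP P⊆⋃ with em c {∃[ Q ] Q ∈ S × P ⊆ Q}
    ... | no ∄ = inj₁ (⋃⊆ S tP λ Q Q∈S →
      [ (λ P⊆Q → contradiction (Q , Q∈S , P⊆Q) ∄)
      , (λ gQ⊆P x → gQ⊆P x ∘ g-inflationary Q x)
      ]′ (extreme-comparable (tS Q Q∈S) (extreme (tS Q Q∈S)) tP))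
    ... | yes (Q , Q∈S , P⊆Q) with extreme (tS Q Q∈S) tP P⊆Q
    ...   | inj₂ gP⊆Q = inj₂ λ x → ⊆⋃ S Q Q∈S x ∘ gP⊆Q x
    -- Now `P` and `Q` have the same elements, and extremeness of `Q` leaves `g Q` open. Comparing
    -- `Q` with the whole union decides: the union stops at `Q` or contains `g Q`.
    ...   | inj₁ Q⊆P
      with extreme-comparable (tS Q Q∈S) (extreme (tS Q Q∈S)) (sup S tS)
    ...     | inj₁ ⋃⊆Q  = inj₁ λ x → Q⊆P x ∘ ⋃⊆Q x
    ...     | inj₂ gQ⊆⋃ = inj₂ λ x → gQ⊆⋃ x ∘ g-extensional P Q (P⊆Q , Q⊆P) x

    chain : ∀ {P Q} → Tower P → Tower Q → P ⊆ Q ⊎ Q ⊆ P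
    chain {P} {Q} tP tQ with extreme-comparable tQ (extreme tQ) tP
    ... | inj₁ P⊆Q  = inj₁ P⊆Q
    ... | inj₂ gQ⊆P = inj₂ λ x → gQ⊆P x ∘ g-inflationary Q x

    top : Subset X
    top = ⋃ ⟪ Tower ⟫

    top-tower : Tower top
    top-tower = sup ⟪ Tower ⟫ λ P → ∈⁻ Tower

    top-fixed : g top ⊆ top
    top-fixed = ⊆⋃ ⟪ Tower ⟫ (g top) (∈⁺ Tower (step top-tower))

  -- Choosing an element extensionally.

  module _ (ac : ∀ a ℓ₁ b ℓ₂ → AxiomOfChoice a ℓ₁ b ℓ₂) where

    -- Excluded middle alone already picks elements; the axiom of choice makes
    -- the picked element depend only on the extension of the subset.
    module Choice {c} {X : Set c} (default : X) where

      Pointed : Set c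
      Pointed = Σ[ P ∈ Subset X ] ∃[ x ] x ∈ P

      pointed : Setoid c c
      pointed = record
        { Carrier       = Pointed
        ; _≈_           = λ (P , x , _) (Q , y , _) → P ≐ Q × x ≡ y
        ; isEquivalence = record
          { refl  = ((λ _ → id) , (λ _ → id)) , refl
          ; sym   = λ ((f , g) , p) → (g , f) , sym p
          ; trans = λ ((f , g) , p) ((f′ , g′) , p′) →
              ((λ x → f′ x ∘ f x) , (λ x → g x ∘ g′ x)) , trans p p′
          }
        }

      inhabited : Setoid c c
      inhabited = record
        { Carrier       = Pointed
        ; _≈_           = λ (P , _) (Q , _) → P ≐ Q
        ; isEquivalence = record
          { refl  = (λ _ → id) , (λ _ → id)
          ; sym   = λ (f , g) → g , f
          ; trans = λ (f , g) (f′ , g′) → (λ x → f′ x ∘ f x) , (λ x → g x ∘ g′ x)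
          }
        }

      -- The two setoids differ only in their equality, so the identity is a surjection. A section
      -- respects the coarser equality, hence gives subsets with the same elements the same point.
      section : Σ[ s ∈ Func inhabited pointed ]
                  (∀ y → proj₁ (Func.to s y) ≐ proj₁ y)
      section = ac c c c c pointed inhabited record
        { to         = id
        ; cong       = proj₁
        ; surjective = λ y → y , proj₁
        }

      pick : ∀ P → Dec (∃[ x ] x ∈ P) → X
      pick P (yes p) = proj₁ (proj₂ (Func.to (proj₁ section) (P , p)))
      pick P (no  _) = default

      pick-∈ : ∀ P d x → x ∈ P → pick P d ∈ P
      pick-∈ P (yes p) _ _ =
        proj₁ (proj₂ section (P , p)) _ (proj₂ (proj₂ (Func.to (proj₁ section) (P , p))))
      pick-∈ P (no ∄)  x x∈P = contradiction (x , x∈P) ∄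

      pick-elim : ∀ {r} (R : X → Set r) P d → (∀ x → x ∈ P → R x) → R default → R (pick P d)
      pick-elim R P d@(yes (x , x∈P)) R-P _ = R-P (pick P d) (pick-∈ P d x x∈P)
      pick-elim R P (no _)            _ R-default = R-default

      pick-ext : ∀ P d Q e → P ≐ Q → pick P d ≡ pick Q e
      pick-ext P (yes p) Q (yes q) P≐Q = proj₂ (Func.cong (proj₁ section) P≐Q)
      pick-ext P (yes (x , x∈P)) Q (no ∄) (P⊆Q , _) = contradiction (x , P⊆Q x x∈P) ∄
      pick-ext P (no ∄) Q (yes (x , x∈Q)) (_ , Q⊆P) = contradiction (x , Q⊆P x x∈Q) ∄
      pick-ext P (no _) Q (no _) _ = refl

      ε : Subset X → X
      ε P = pick P (em c)

    -- The prime filter theorem.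

    module PrimeFilterTheorem
      {c ℓ p q} (L : BoundedDistributiveLattice c ℓ)
      {F : BoundedDistributiveLattice.Carrier L → Set p} (F-filter : IsFilter L F)
      {I : BoundedDistributiveLattice.Carrier L → Set q} (I-ideal : IsIdeal L I)
      (F∩I≡∅ : ∀ {x} → F x → ¬ I x)
      where

      open BoundedDistributiveLattice L
        using (Carrier; ⊤; _∧_; _∨_; ∧-distribˡ-∨)
      open Order L
      open Choice ⊤
      module I = IsIdeal I-ideal

      -- For a filter `P`, the filter generated by `P` and `x`.
      Adjoin : Subset Carrier → Carrier → Carrier → Set (c ⊔ ℓ)
      Adjoin P x z = ∃[ w ] w ∈ P × w ∧ x ≤ z

      Disjoint : Subset Carrier → Carrier → Set (c ⊔ ℓ ⊔ q)
      Disjoint P x = ∀ z → Adjoin P x z → ¬ I z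

      -- Asking for `x` outside `P` makes the enlargement proper, so a filter closed under `extend`
      -- has no candidates.
      Candidate : Subset Carrier → Carrier → Set (c ⊔ ℓ ⊔ q)
      Candidate P x = ¬ x ∈ P × Disjoint P x

      candidates : Subset Carrier → Subset Carrier
      candidates P = ⟪ Candidate P ⟫

      -- When P has no candidate the new generator is ⊤, which adds nothing.
      generator : Subset Carrier → Carrier
      generator P = ε (candidates P)

      extend : Subset Carrier → Subset Carrier
      extend P = ⟪ Adjoin P (generator P) ⟫

      adjoin-mono : ∀ P Q → P ⊆ Q → ∀ {x z} → Adjoin P x z → Adjoin Q x z
      adjoin-mono P Q P⊆Q (w , w∈P , le) = w , P⊆Q w w∈P , le

      candidates-mono : ∀ P Q → P ≐ Q → candidates P ⊆ candidates Q
      candidates-mono P Q (P⊆Q , Q⊆P) x x∈ =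
        let x∉P , disj = ∈⁻ (Candidate P) x∈ in
        ∈⁺ (Candidate Q) (x∉P ∘ Q⊆P x , λ z → disj z ∘ adjoin-mono Q P Q⊆P)

      extend-inflationary : ∀ P → P ⊆ extend P
      extend-inflationary P x x∈P = ∈⁺ (Adjoin P (generator P)) (x , x∈P , x∧y≤x _ _)

      extend-extensional : ∀ P Q → P ≐ Q → extend P ⊆ extend Q
      extend-extensional P Q P≐Q@(P⊆Q , Q⊆P) z z∈ =
        ∈⁺ (Adjoin Q (generator Q))
          (subst (λ x → Adjoin Q x z) same-generator
            (adjoin-mono P Q P⊆Q (∈⁻ (Adjoin P (generator P)) z∈)))
        where
        -- The enlargement is extensional because the choice of its generator is.
        same-generator : generator P ≡ generator Q
        same-generator = pick-ext (candidates P) (em c) (candidates Q) (em c)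
          (candidates-mono P Q P≐Q , candidates-mono Q P (Q⊆P , P⊆Q))

      open Tower ⟪ F ⟫ extend extend-inflationary extend-extensional

      record Good (P : Subset Carrier) : Set (c ⊔ ℓ ⊔ q) where
        field
          filter   : IsFilter L (_∈ P)
          disjoint : ∀ {x} → x ∈ P → ¬ I x

      generator-disjoint : ∀ P → Good P → Disjoint P (generator P)
      generator-disjoint P good =
        pick-elim (Disjoint P) (candidates P) (em c)
          (λ x x∈ → proj₂ (∈⁻ (Candidate P) x∈))
          (λ z (w , w∈P , w∧⊤≤z) →
            disjoint (up (≤-trans (∧-greatest ≤-refl x≤⊤) w∧⊤≤z) w∈P))
        where
        open Good good
        open IsFilter filter

      extend-good : ∀ P → Good P → Good (extend P)
      extend-good P good = record
        { filter   = record
          { ⊤-closed = extend-inflationary P ⊤ ⊤-closed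
          ; ∧-closed = λ x∈ y∈ →
              let v , v∈P , v∧g≤x = ∈⁻ A x∈
                  w , w∈P , w∧g≤y = ∈⁻ A y∈
              in ∈⁺ A
                ( v ∧ w , ∧-closed v∈P w∈P
                , ∧-greatest (≤-trans (∧-monotonic (x∧y≤x v w) ≤-refl) v∧g≤x)
                             (≤-trans (∧-monotonic (x∧y≤y v w) ≤-refl) w∧g≤y))
          ; up       = λ x≤y x∈ →
              let w , w∈P , w∧g≤x = ∈⁻ A x∈ in ∈⁺ A (w , w∈P , ≤-trans w∧g≤x x≤y)
          }
        ; disjoint = λ x∈ → generator-disjoint P good _ (∈⁻ A x∈)
        }
        where
        open Good good
        open IsFilter filter
        A = Adjoin P (generator P)

      base-good : Good ⟪ F ⟫
      base-good = record
        { filter   = record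
          { ⊤-closed = ∈⁺ F ⊤-closed
          ; ∧-closed = λ x∈ y∈ → ∈⁺ F (∧-closed (∈⁻ F x∈) (∈⁻ F y∈))
          ; up       = λ x≤y x∈ → ∈⁺ F (up x≤y (∈⁻ F x∈))
          }
        ; disjoint = F∩I≡∅ ∘ ∈⁻ F
        }
        where open IsFilter F-filter

      -- Closure under meets rests on the chain property: elements of two members both lie in the
      -- larger one. Elements of `F` lie in every member.
      sup-good : ∀ S → (∀ P → P ∈ S → Tower P) → (∀ P → P ∈ S → Good P) → Good (⋃ S)
      sup-good S tS good = record
        { filter   = record
          { ⊤-closed = ∈⁺ A (inj₁ (IsFilter.⊤-closed (Good.filter base-good)))
          ; ∧-closed = λ x∈ y∈ → ∈⁺ A (meet (∈⁻ A x∈) (∈⁻ A y∈))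
          ; up       = λ x≤y x∈ → ∈⁺ A (above x≤y (∈⁻ A x∈))
          }
        ; disjoint = apart ∘ ∈⁻ A
        }
        where
        A = InUnion S

        meet-in : ∀ {P x y} → P ∈ S → x ∈ P → y ∈ P → A (x ∧ y)
        meet-in {P} P∈S x∈P y∈P =
          inj₂ (P , P∈S , IsFilter.∧-closed (Good.filter (good P P∈S)) x∈P y∈P)

        meet : ∀ {x y} → A x → A y → A (x ∧ y)
        meet (inj₁ x∈) (inj₁ y∈) =
          inj₁ (IsFilter.∧-closed (Good.filter base-good) x∈ y∈)
        meet (inj₁ x∈) (inj₂ (P , P∈S , y∈)) = meet-in {P} P∈S (F₀⊆ (tS P P∈S) _ x∈) y∈
        meet (inj₂ (P , P∈S , x∈)) (inj₁ y∈) = meet-in {P} P∈S x∈ (F₀⊆ (tS P P∈S) _ y∈)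
        meet (inj₂ (P , P∈S , x∈)) (inj₂ (Q , Q∈S , y∈))
          with chain (tS P P∈S) (tS Q Q∈S)
        ... | inj₁ P⊆Q = meet-in {Q} Q∈S (P⊆Q _ x∈) y∈
        ... | inj₂ Q⊆P = meet-in {P} P∈S x∈ (Q⊆P _ y∈)

        above : ∀ {x y} → x ≤ y → A x → A y
        above x≤y (inj₁ x∈) = inj₁ (IsFilter.up (Good.filter base-good) x≤y x∈)
        above x≤y (inj₂ (P , P∈S , x∈)) =
          inj₂ (P , P∈S , IsFilter.up (Good.filter (good P P∈S)) x≤y x∈)

        apart : ∀ {x} → A x → ¬ I x
        apart (inj₁ x∈)             = Good.disjoint base-good x∈
        apart (inj₂ (P , P∈S , x∈)) = Good.disjoint (good P P∈S) x∈

      tower-good : ∀ {P} → Tower P → Good P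
      tower-good (step {P} t) = extend-good P (tower-good t)
      tower-good (sup S tS)   = sup-good S tS λ P P∈S → tower-good (tS P P∈S)

      open Good (tower-good top-tower) renaming (filter to top-filter; disjoint to top∩I≡∅)

      -- Otherwise `x` is a candidate, so the generator of `top` is one too and lies outside `top`;
      -- but `extend` adds it, and `top` is closed under `extend`.
      top-maximal : ∀ {x} → ¬ x ∈ top → ∃[ z ] Adjoin top x z × I z
      top-maximal {x} x∉top with em (c ⊔ ℓ ⊔ q) {∃[ z ] Adjoin top x z × I z}
      ... | yes meets = meets
      ... | no ∄ = contradiction generator∈top (proj₁ generator-candidate)
        where
        generator-candidate : Candidate top (generator top)
        generator-candidate = ∈⁻ (Candidate top)
          (pick-∈ (candidates top) (em c) x
            (∈⁺ (Candidate top) (x∉top , λ z a i → ∄ (z , a , i))))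

        generator∈top : generator top ∈ top
        generator∈top = top-fixed _ (∈⁺ (Adjoin top (generator top))
          (⊤ , IsFilter.⊤-closed top-filter , x∧y≤y _ _))

      -- If both are missing, maximality gives `v ∧ x ≤ i` and `w ∧ y ≤ j` with `v`, `w` in `top`
      -- and `i`, `j` in the ideal. By distributivity `(v ∧ w) ∧ (x ∨ y) ≤ i ∨ j`, so `top` meets
      -- the ideal.
      top-prime : ∀ {x y} → x ∨ y ∈ top → x ∈ top ⊎ y ∈ top
      top-prime {x} {y} x∨y∈ with em 0ℓ {x ∈ top} | em 0ℓ {y ∈ top}
      ... | yes x∈ | _      = inj₁ x∈
      ... | no _   | yes y∈ = inj₂ y∈
      ... | no x∉  | no y∉  =
        let i , (v , v∈ , v∧x≤i) , Ii = top-maximal x∉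
            j , (w , w∈ , w∧y≤j) , Ij = top-maximal y∉
            open IsFilter top-filter
        in contradiction (I.∨-closed Ii Ij) (top∩I≡∅
          (up (≤-trans (≤-reflexive (∧-distribˡ-∨ (v ∧ w) x y))
                (∨-least
                  (≤-trans (∧-monotonic (x∧y≤x v w) ≤-refl) (≤-trans v∧x≤i (x≤x∨y i j)))
                  (≤-trans (∧-monotonic (x∧y≤y v w) ≤-refl) (≤-trans w∧y≤j (y≤x∨y i j)))))
              (∧-closed (∧-closed v∈ w∈) x∨y∈)))

      primeFilter : Σ[ P ∈ Subset Carrier ] IsPrimeFilter L (_∈ P)
                      × (∀ {x} → F x → x ∈ P) × (∀ {x} → x ∈ P → ¬ I x)
      primeFilter = top , record { isFilter = top-filter ; prime = top-prime }
                  , F₀⊆ top-tower _ ∘ ∈⁺ F , top∩I≡∅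

  -- Atoms of a finite Boolean algebra.

  module FiniteBoolean {b ℓ} (B : BooleanAlgebra b ℓ)
                       (finite : Finite (BooleanAlgebra.setoid B)) where

    open BooleanAlgebra B using (Carrier; _∧_; _∨_; ⊥; _≈_)
      renaming (¬_ to ∁_)
    private module B = BooleanAlgebra B
    open Order (boundedDistributiveLattice B)

    size = proj₁ finite

    open Inverse (proj₂ finite) public using ()
      renaming (to to index; from to elem; inverseˡ to index-elem; strictlyInverseʳ to elem-index)

    Splits : Carrier → Carrier → Set ℓ
    Splits a x = a ≤ x ⊎ a ∧ x ≤ ⊥

    -- Equivalent to `a` being minimal among the nonzero elements; in this form join-primeness
    -- follows directly from distributivity.
    record Atom (a : Carrier) : Set (b ⊔ ℓ) where
      field
        nonzero : ¬ a ≤ ⊥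
        splits  : ∀ x → Splits a x

      ∨-prime : ∀ {x y} → a ≤ x ∨ y → a ≤ x ⊎ a ≤ y
      ∨-prime {x} {y} a≤x∨y with splits x | splits y
      ... | inj₁ a≤x | _        = inj₁ a≤x
      ... | inj₂ _   | inj₁ a≤y = inj₂ a≤y
      ... | inj₂ a∧x≤⊥ | inj₂ a∧y≤⊥ = contradiction
        (≤-trans (∧-greatest ≤-refl a≤x∨y)
          (≤-trans (≤-reflexive (B.∧-distribˡ-∨ a x y)) (∨-least a∧x≤⊥ a∧y≤⊥)))
        nonzero

    atom-antichain : ∀ {a e} → Atom a → Atom e → a ≤ e → e ≤ a
    atom-antichain {a} atomₐ atomₑ a≤e with Atom.splits atomₑ a
    ... | inj₁ e≤a   = e≤a
    ... | inj₂ e∧a≤⊥ =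
      contradiction (≤-trans (∧-greatest a≤e ≤-refl) e∧a≤⊥) (Atom.nonzero atomₐ)

    splits-resp : ∀ {a a′ x x′} → a ≈ a′ → x ≈ x′ → Splits a x → Splits a′ x′
    splits-resp a≈a′ x≈x′ (inj₁ a≤x) =
      inj₁ (≤-trans (≤-reflexive (B.sym a≈a′)) (≤-trans a≤x (≤-reflexive x≈x′)))
    splits-resp a≈a′ x≈x′ (inj₂ a∧x≤⊥) =
      inj₂ (≤-trans (≤-reflexive (B.sym (B.∧-cong a≈a′ x≈x′))) a∧x≤⊥)

    -- Meet `x` with each `f i` in turn unless that gives `⊥`. Both alternatives of `Splits` persist
    -- when the element shrinks, so early decisions survive.
    splitting-below : ∀ n (f : Fin n → Carrier) {x} → ¬ x ≤ ⊥ →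
                      ∃[ a ] ¬ a ≤ ⊥ × a ≤ x × (∀ i → Splits a (f i))
    splitting-below zero f {x} x≰⊥ = x , x≰⊥ , ≤-refl , λ ()
    splitting-below (suc n) f {x} x≰⊥ with em ℓ {x ∧ f zero ≤ ⊥}
    ... | yes x∧f₀≤⊥ =
      let a , a≰⊥ , a≤x , s = splitting-below n (f ∘ suc) x≰⊥ in
      a , a≰⊥ , a≤x , λ
        { zero    → inj₂ (≤-trans (∧-monotonic a≤x ≤-refl) x∧f₀≤⊥)
        ; (suc i) → s i }
    ... | no x∧f₀≰⊥ =
      let a , a≰⊥ , a≤x∧f₀ , s = splitting-below n (f ∘ suc) x∧f₀≰⊥ in
      a , a≰⊥ , ≤-trans a≤x∧f₀ (x∧y≤x _ _) , λ
        { zero    → inj₁ (≤-trans a≤x∧f₀ (x∧y≤y _ _))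
        ; (suc i) → s i }

    elem-injective : ∀ {i j} → elem i ≈ elem j → i ≡ j
    elem-injective eᵢ≈eⱼ = trans (sym (index-elem B.refl)) (index-elem eᵢ≈eⱼ)

    -- An element that splits the whole enumeration splits all of `B`. It is then replaced by its
    -- listed representative, so that atoms are indexed by `Fin size`.
    atom-below : ∀ {x} → ¬ x ≤ ⊥ → ∃[ i ] Atom (elem i) × elem i ≤ x
    atom-below x≰⊥ =
      let a , a≰⊥ , a≤x , s = splitting-below size elem x≰⊥
          e≈a = elem-index a
      in index a
       , record
         { nonzero = a≰⊥ ∘ ≤-trans (≤-reflexive (B.sym e≈a))
         ; splits  = λ y → splits-resp (B.sym e≈a) (elem-index y) (s (index y))
         }
       , ≤-trans (≤-reflexive e≈a) a≤x

    -- An atom below `x ∧ ∁ y` would lie below `x`, hence below `y`, and also below `∁ y`. So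
    -- `x ∧ ∁ y` is zero.
    atoms-separate : ∀ {x y} → (∀ i → Atom (elem i) → elem i ≤ x → elem i ≤ y) → x ≤ y
    atoms-separate {x} {y} below with em ℓ {x ∧ ∁ y ≤ ⊥}
    ... | yes x∧∁y≤⊥ =
      ≤-trans (∧-greatest ≤-refl (≤-trans x≤⊤ (≤-reflexive (B.sym (B.∨-complementʳ y)))))
        (≤-trans (≤-reflexive (B.∧-distribˡ-∨ x y (∁ y)))
          (∨-least (x∧y≤y x y) (≤-trans x∧∁y≤⊥ ⊥≤x)))
    ... | no x∧∁y≰⊥ =
      let i , atom , e≤ = atom-below x∧∁y≰⊥ in
      contradiction
        (≤-trans (∧-greatest (below i atom (≤-trans e≤ (x∧y≤x _ _))) (≤-trans e≤ (x∧y≤y _ _)))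
          (≤-reflexive (B.∧-complementʳ y)))
        (Atom.nonzero atom)

    -- The last component is join-primeness of atoms, iterated along the finite join.
    join : ∀ n (f : Fin n → Carrier) {s} (S : Fin n → Set s) →
           ∃[ x ] (∀ i → S i → f i ≤ x) × (∀ {a} → Atom a → a ≤ x → ∃[ i ] S i × a ≤ f i)
    join zero f S = ⊥ , (λ ()) , λ atom a≤⊥ → contradiction a≤⊥ (Atom.nonzero atom)
    join (suc n) f {s} S with join n (f ∘ suc) (S ∘ suc) | em s {S zero}
    ... | x , upper , below | yes S₀ =
      f zero ∨ x
      , (λ { zero _ → x≤x∨y _ _ ; (suc i) Si → ≤-trans (upper i Si) (y≤x∨y _ _) })
      , λ atom a≤ →
          [ (λ a≤f₀ → zero , S₀ , a≤f₀)
          , (λ a≤x → let i , Si , a≤fi = below atom a≤x in suc i , Si , a≤fi)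
          ]′ (Atom.∨-prime atom a≤)
    ... | x , upper , below | no ¬S₀ =
      x
      , (λ { zero S₀ → contradiction S₀ ¬S₀ ; (suc i) Si → upper i Si })
      , λ atom a≤x → let i , Si , a≤fi = below atom a≤x in suc i , Si , a≤fi

-- Extending `α` along `φ`.

module Extension
  (em : ∀ ℓ → ExcludedMiddle ℓ) (ac : ∀ a ℓ₁ b ℓ₂ → AxiomOfChoice a ℓ₁ b ℓ₂)
  {b ℓ} (B : BooleanAlgebra b ℓ) (finite : Finite (BooleanAlgebra.setoid B))
  {c₁ ℓ₁ c₂ ℓ₂}
  (L : BoundedDistributiveLattice c₁ ℓ₁) (L′ : BoundedDistributiveLattice c₂ ℓ₂)
  (φ : LatticeMap L L′) (φ-inj : LatticeMap.Injective φ)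
  (α : LatticeMap L (boundedDistributiveLattice B))
  where

  open Classical em
  open FiniteBoolean B finite
  open BooleanAlgebra B using (Carrier; _≈_; _∧_; _∨_)
  open Order (boundedDistributiveLattice B)
  private
    module B  = BooleanAlgebra B
    module L  = BoundedDistributiveLattice L
    module L′ = BoundedDistributiveLattice L′
    module ≤L = Order L
    module ≤′ = Order L′
    module α  = LatticeMap α
    module φ  = LatticeMap φ

  -- `complete` and `sound` say that the preimage of `P` along `φ` is the preimage along `α` of the
  -- principal filter of `e`.
  record Extends (e : Carrier) (P : Subset L′.Carrier) : Set (c₁ ⊔ ℓ ⊔ c₂ ⊔ ℓ₂) where
    field
      isPrimeFilter : IsPrimeFilter L′ (_∈ P)
      complete      : ∀ {x} → e ≤ α.to x → φ.to x ∈ P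
      sound         : ∀ {x} → φ.to x ∈ P → e ≤ α.to x

    open IsPrimeFilter isPrimeFilter public

  extending : ∀ e → Atom e → Σ[ P ∈ Subset L′.Carrier ] Extends e P
  extending e atom =
    let P , P-prime , F⊆P , P∩I≡∅ = PrimeFilterTheorem.primeFilter ac L′ F-filter I-ideal
          λ (x , e≤αx , φx≤z) (y , e≰αy , z≤φy) →
            -- From `φ x ≤ z ≤ φ y` injectivity yields `x ≤ y`, hence `e ≤ α x ≤ α y`.
            e≰αy (≤-trans e≤αx (mono α (reflect φ φ-inj (≤′.≤-trans φx≤z z≤φy))))
    in P , record
      { isPrimeFilter = P-prime
      ; complete      = λ {x} e≤αx → F⊆P (x , e≤αx , ≤′.≤-refl)
      ; sound         = λ {x} φx∈P → sound x φx∈P P∩I≡∅ (em ℓ)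
      }
    where
    F : L′.Carrier → Set (c₁ ⊔ ℓ ⊔ ℓ₂)
    F z = ∃[ x ] e ≤ α.to x × φ.to x ≤′.≤ z

    I : L′.Carrier → Set (c₁ ⊔ ℓ ⊔ ℓ₂)
    I z = ∃[ x ] ¬ e ≤ α.to x × z ≤′.≤ φ.to x

    sound : ∀ x {P : Subset L′.Carrier} → φ.to x ∈ P → (∀ {z} → z ∈ P → ¬ I z) →
            Dec (e ≤ α.to x) → e ≤ α.to x
    sound x φx∈P P∩I≡∅ (yes e≤αx) = e≤αx
    sound x φx∈P P∩I≡∅ (no e≰αx)  = contradiction (x , e≰αx , ≤′.≤-refl) (P∩I≡∅ φx∈P)

    F-filter : IsFilter L′ F
    F-filter = record
      { ⊤-closed = L.⊤ , ≤-trans x≤⊤ (≤-reflexive (B.sym α.⊤-homo)) , ≤′.x≤⊤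
      ; ∧-closed = λ (x , e≤αx , φx≤) (y , e≤αy , φy≤) →
          x L.∧ y
          , ≤-trans (∧-greatest e≤αx e≤αy) (≤-reflexive (B.sym (α.∧-homo x y)))
          , ≤′.≤-trans (≤′.≤-reflexive (φ.∧-homo x y)) (≤′.∧-monotonic φx≤ φy≤)
      ; up       = λ y≤z (x , e≤αx , φx≤y) → x , e≤αx , ≤′.≤-trans φx≤y y≤z
      }

    -- Being an atom enters twice: `e` is nonzero, which puts `⊥` in `I`, and join-prime, which
    -- closes `I` under joins.
    I-ideal : IsIdeal L′ I
    I-ideal = record
      { ⊥-closed = L.⊥ , (λ e≤α⊥ → Atom.nonzero atom (≤-trans e≤α⊥ (≤-reflexive α.⊥-homo)))
                 , ≤′.⊥≤x
      ; ∨-closed = λ (x , e≰αx , ≤φx) (y , e≰αy , ≤φy) →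
          x L.∨ y
          , (λ e≤ → [ e≰αx , e≰αy ]′
              (Atom.∨-prime atom (≤-trans e≤ (≤-reflexive (α.∨-homo x y)))))
          , ≤′.∨-least (≤′.≤-trans ≤φx (mono φ (≤L.x≤x∨y x y)))
                       (≤′.≤-trans ≤φy (mono φ (≤L.y≤x∨y x y)))
      ; down     = λ y≤z (x , e≰αx , z≤φx) → x , e≰αx , ≤′.≤-trans y≤z z≤φx
      }

  -- Totality in `i`, with the full subset as filler, makes `Q i` depend on the index alone and not
  -- on a proof of atomicity; membership can then be transported along equal indices.
  extendingOrAll : ∀ i → Dec (Atom (elem i)) →
                   Σ[ P ∈ Subset L′.Carrier ] (Atom (elem i) → Extends (elem i) P)
  extendingOrAll i (yes atom) = let P , ext = extending (elem i) atom in P , λ _ → ext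
  extendingOrAll i (no ¬atom) = (λ _ → true) , λ atom → contradiction atom ¬atom

  Q : Fin size → Subset L′.Carrier
  Q i = proj₁ (extendingOrAll i (em (b ⊔ ℓ)))

  module Q {i} (atom : Atom (elem i)) =
    Extends (proj₂ (extendingOrAll i (em (b ⊔ ℓ))) atom)

  Selected : L′.Carrier → Fin size → Set (b ⊔ ℓ)
  Selected y i = Atom (elem i) × y ∈ Q i

  β : L′.Carrier → Carrier
  β y = proj₁ (join size elem (Selected y))

  ∈⇒≤β : ∀ {i y} → Atom (elem i) → y ∈ Q i → elem i ≤ β y
  ∈⇒≤β {i} {y} atom y∈Q = proj₁ (proj₂ (join size elem (Selected y))) i (atom , y∈Q)

  ≤β⇒∈ : ∀ {i y} → Atom (elem i) → elem i ≤ β y → y ∈ Q i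
  ≤β⇒∈ {i} {y} atom e≤βy =
    -- The selected atom `elem j` found above `elem i` coincides with it, comparable atoms being
    -- equal; the enumeration has no repetitions, so `j` is `i`.
    let j , (atomⱼ , y∈Qⱼ) , eᵢ≤eⱼ = proj₂ (proj₂ (join size elem (Selected y))) atom e≤βy
        eⱼ≈eᵢ = antisym (atom-antichain atom atomⱼ eᵢ≤eⱼ) eᵢ≤eⱼ
    in subst (λ k → y ∈ Q k) (elem-injective eⱼ≈eᵢ) y∈Qⱼ

  β-mono : ∀ {y z} → y ≤′.≤ z → β y ≤ β z
  β-mono y≤z = atoms-separate λ i atom e≤βy →
    ∈⇒≤β atom (Q.up atom y≤z (≤β⇒∈ atom e≤βy))

  β-∧ : ∀ y z → β (y L′.∧ z) ≈ β y ∧ β z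
  β-∧ y z = antisym
    (∧-greatest (β-mono (≤′.x∧y≤x y z)) (β-mono (≤′.x∧y≤y y z)))
    (atoms-separate λ i atom e≤ → ∈⇒≤β atom (Q.∧-closed atom
      (≤β⇒∈ atom (≤-trans e≤ (x∧y≤x _ _)))
      (≤β⇒∈ atom (≤-trans e≤ (x∧y≤y _ _)))))

  β-∨ : ∀ y z → β (y L′.∨ z) ≈ β y ∨ β z
  β-∨ y z = antisym
    (atoms-separate λ i atom e≤ →
      [ (λ y∈ → ≤-trans (∈⇒≤β atom y∈) (x≤x∨y _ _))
      , (λ z∈ → ≤-trans (∈⇒≤β atom z∈) (y≤x∨y _ _))
      ]′ (Q.prime atom (≤β⇒∈ atom e≤)))
    (∨-least (β-mono (≤′.x≤x∨y y z)) (β-mono (≤′.y≤x∨y y z)))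

  α≈β∘φ : ∀ x → α.to x ≈ β (φ.to x)
  α≈β∘φ x = antisym
    (atoms-separate λ i atom e≤ → ∈⇒≤β atom (Q.complete atom e≤))
    (atoms-separate λ i atom e≤ → Q.sound atom (≤β⇒∈ atom e≤))

  β-cong : ∀ {y z} → y L′.≈ z → β y ≈ β z
  β-cong y≈z = antisym (β-mono (≤′.≤-reflexive y≈z)) (β-mono (≤′.≤-reflexive (L′.sym y≈z)))

  β-map : LatticeMap L′ (boundedDistributiveLattice B)
  β-map = record
    { to                    = β
    ; isLatticeHomomorphism = record
      { isRelHomomorphism = record { cong = β-cong }
      ; ∧-homo            = β-∧
      ; ∨-homo            = β-∨
      }
    -- The bounds of `L′` are images of those of `L`, so their values under `β` are read off from
    -- `α`.
    ; ⊤-homo = B.trans (β-cong (L′.sym φ.⊤-homo)) (B.trans (B.sym (α≈β∘φ L.⊤)) α.⊤-homo)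
    ; ⊥-homo = B.trans (β-cong (L′.sym φ.⊥-homo)) (B.trans (B.sym (α≈β∘φ L.⊥)) α.⊥-homo)
    }

corollary3p18 :
    (∀ ℓ → ExcludedMiddle ℓ) →
    (∀ a ℓ₁ b ℓ₂ → AxiomOfChoice a ℓ₁ b ℓ₂) →
    ∀ {b ℓ} (B : BooleanAlgebra b ℓ) →
    Finite (BooleanAlgebra.setoid B) →
    IsInjectiveObject (boundedDistributiveLattice B)
corollary3p18 em ac B finite L L′ φ φ-inj α = β-map , α≈β∘φ
  where open Extension em ac B finite L L′ φ φ-inj α
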